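{- Let $n \geq 1$ and let $(a_1, a_2, \ldots, a_n)$ be a palindromic sequence of positive integers (i.e. $a_i = a_{n+1-i}$ for all $i$). Then there exist integers $k_1$, $w$, $z$, depending only on the sequence $(a_1,\ldots,a_n)$, such that for every integer $k \geq k_1$ we have $w + zk \geq 1$ and the real number $$\alpha = [0; \overline{a_1, a_2, \ldots, a_n, w + zk}]$$ is an algebraic integer of degree $2$ with $0 < \alpha < 1$. In particular, there exist infinitely many algebraic integers $\alpha$ of degree $2$ with $0<\alpha<1$ of this form.
   Context: For integers $b_0$ and positive integers $b_1, b_2, \ldots$, $[b_0; b_1, b_2, \ldots]$ denotes the simple continued fraction $b_0 + \cfrac{1}{b_1 + \cfrac{1}{b_2 + \cdots}}$, and $\overline{c_1, \ldots, c_r}$ denotes that the block $c_1, \ldots, c_r$ is repeated periodically forever. -}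

module Defs where

open import Data.Nat as ℕ using (ℕ; zero; suc)
open import Data.Integer as ℤ using (ℤ)
open import Data.Rational as ℚ using (ℚ; 0ℚ; 1ℚ; _+_; _-_; _*_; ∣_∣; 1/_; ≢-nonZero)
open import Data.Rational.Properties using (_≟_)
open import Data.List using (List; []; _∷_; _++_; take; length; map)
open import Data.List.Relation.Unary.Any using (Any)
open import Data.Product using (Σ; ∃; ∃-syntax; _×_; _,_)
open import Relation.Nullary using (¬_; yes; no)
open import Relation.Binary.PropositionalEquality using (_≡_; _≢_)

-- Real numbers are represented by sequences of rationals (the paper's
-- real number α is the limit of its continued-fraction convergents).

Seq : Set
Seq = ℕ → ℚ

IsCauchy : Seq → Set
IsCauchy x = ∀ (ε : ℚ) → 0ℚ ℚ.< ε →
  ∃[ N ] (∀ m n → N ℕ.≤ m → N ℕ.≤ n → ∣ x m - x n ∣ ℚ.< ε)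

Tendsto : Seq → ℚ → Set
Tendsto x q = ∀ (ε : ℚ) → 0ℚ ℚ.< ε →
  ∃[ N ] (∀ n → N ℕ.≤ n → ∣ x n - q ∣ ℚ.< ε)

_≃ᵣ_ : Seq → Seq → Set
x ≃ᵣ y = ∀ (ε : ℚ) → 0ℚ ℚ.< ε →
  ∃[ N ] (∀ n → N ℕ.≤ n → ∣ x n - y n ∣ ℚ.< ε)

Positive : Seq → Set
Positive x = ∃[ ε ] (0ℚ ℚ.< ε × ∃[ N ] (∀ n → N ℕ.≤ n → ε ℚ.≤ x n))

LessThanOne : Seq → Set
LessThanOne x = ∃[ ε ] (0ℚ ℚ.< ε × ∃[ N ] (∀ n → N ℕ.≤ n → x n + ε ℚ.≤ 1ℚ))

evalPoly : List ℚ → ℚ → ℚ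
evalPoly []       t = 0ℚ
evalPoly (c ∷ cs) t = c + t * evalPoly cs t

-- the (continuous) polynomial p vanishes at the real number lim x
IsRoot : List ℚ → Seq → Set
IsRoot p x = Tendsto (λ n → evalPoly p (x n)) 0ℚ

NonZeroPoly : List ℚ → Set
NonZeroPoly p = Any (λ c → c ≢ 0ℚ) p

intToℚ : ℤ → ℚ
intToℚ z = z ℚ./ 1

IsAlgebraicInteger : Seq → Set
IsAlgebraicInteger x =
  ∃[ cs ] IsRoot (map intToℚ (cs ++ (ℤ.+ 1 ∷ []))) x

IsAlgebraicOfDegree2 : Seq → Set
IsAlgebraicOfDegree2 x =
  (∃[ p ] (length p ℕ.≤ 3 × NonZeroPoly p × IsRoot p x)) ×
  (∀ p → length p ℕ.≤ 2 → NonZeroPoly p → ¬ IsRoot p x)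

IsAlgebraicIntegerOfDegree2 : Seq → Set
IsAlgebraicIntegerOfDegree2 x = IsAlgebraicInteger x × IsAlgebraicOfDegree2 x

-- reciprocal with junk value 1/0 = 0 (never used for positive entries)
inv : ℚ → ℚ
inv x with x ≟ 0ℚ
... | yes _ = 0ℚ
... | no ne = 1/_ x {{≢-nonZero ne}}

cf0 : List ℕ → ℚ
cf0 []       = 0ℚ
cf0 (b ∷ bs) = inv (intToℚ (ℤ.+ b) + cf0 bs)

repeatList : ℕ → List ℕ → List ℕ
repeatList zero    l = []
repeatList (suc k) l = l ++ repeatList k l

-- n-th convergent [0; c₁, …, cₙ] of [0; c₁, c₂, …] where (cᵢ) is the
-- periodic sequence with period l; the real number [0; \overline{l}]
-- is the limit of this sequence.
periodicCF : List ℕ → Seq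
periodicCF l n = cf0 (take n (repeatList n l))

{-# OPTIONS --safe #-}
-- Let [[A,B],[B,D]] be the product of the matrices [[0,1],[1,aᵢ]]; it is symmetric because the
-- sequence is a palindrome, and AD − B² = ε = ±1.  A real α = [0; a₁, …, aₙ, m + α] satisfies
-- D α² + D m α = A + B m, so α is an algebraic integer as soon as D divides A + B m.  As
-- B² ≡ − ε (mod D), this holds for m = ε A B + D k.  A rational root of the resulting monic
-- quadratic would be an integer, whereas 0 < α < 1; and two values of k cannot give the same α,
-- because the difference of their quadratics would be a linear polynomial vanishing at α.
module Submission where

open import Defs

-- A real number is available only as the sequence of its convergents, so there is no α to
-- substitute into an equation. Periodicity survives as an exact relation between the convergents of
-- index `n` and `length l + n`, and each algebraic equation for α becomes the claim that a sequence
-- of rationals is null, proved by exhibiting it as a bounded sequence times a known null one. For a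
-- general matrix [[A,B],[C,D]] the equation would be D α² + (D m + C - B) α = A + B m. Symmetry
-- acts twice: it removes C - B, so that the middle coefficient is divisible by D whatever m is, and
-- it turns the determinant into AD - B², so that B has the explicit inverse - ε B modulo D.

module _ where

  open import Data.Nat.Base as ℕ using (ℕ; zero; suc)
  import Data.Nat.Properties as ℕₚ
  import Data.Nat.Divisibility as ℕ
  import Data.Nat.Coprimality as Coprimality
  import Data.Nat.Tactic.RingSolver as ℕ-RingSolver
  open import Data.Integer.Base as ℤ using (ℤ; +_)
  import Data.Integer.Properties as ℤₚ
  open import Data.Integer.Tactic.RingSolver using (solve-∀)
  import Data.Rational.Unnormalised.Base as ℚᵘ
  open import Data.Rational.Base as ℚ
    using (ℚ; mkℚ; 0ℚ; 1ℚ; ½; _+_; _*_; _-_; -_; 1/_; _<_; _≤_; *≤*; *<*; ∣_∣; nonNegative; positive)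
  open import Data.Rational.Properties
  open import Data.Rational.Solver using (module +-*-Solver)
  open +-*-Solver
  open import Data.List.Base
    using (List; []; _∷_; _++_; _∷ʳ_; length; reverse; lookup; tabulate; take; drop)
  open import Data.List.Properties
    using (++-assoc; length-++; unfold-reverse; reverse-++; tabulate-lookup; tabulate-cong;
           length-take; take++drop≡id; take-take)
  open import Data.List.Relation.Unary.All using (All; []; _∷_)
  open import Data.List.Relation.Unary.All.Properties using (++⁺; ++⁻ˡ; ++⁻ʳ; take⁺)
  open import Data.List.Relation.Unary.Any using (here; there)
  open import Data.Fin.Base using (Fin; zero; suc; opposite; inject₁; fromℕ)
  open import Data.Product using (∃-syntax; _×_; _,_; proj₁; proj₂)
  open import Data.Sum.Base using (_⊎_; inj₁; inj₂)
  open import Function.Base using (_∘_; case_of_)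
  open import Relation.Binary.PropositionalEquality
  open import Relation.Nullary using (¬_; yes; no)
  open import Relation.Nullary.Negation using (contradiction)

  -- Integers and null sequences in ℚ

  -- Opaque, so that the gcd normalisation inside intToℚ never unfolds.
  opaque
    ι : ℤ → ℚ
    ι = intToℚ

    ι≡intToℚ : ∀ z → ι z ≡ intToℚ z
    ι≡intToℚ z = refl

    ι-0 : ι (+ 0) ≡ 0ℚ
    ι-0 = refl

    ι-1 : ι (+ 1) ≡ 1ℚ
    ι-1 = refl

    ι-mkℚ : ∀ z → ι z ≡ mkℚ z 0 (Coprimality.sym (Coprimality.1-coprimeTo _))
    ι-mkℚ z = ↥p/↧p≡p (mkℚ z 0 _)

    ι-+ : ∀ a b → ι (a ℤ.+ b) ≡ ι a + ι b
    ι-+ a b rewrite ι-mkℚ a | ι-mkℚ b =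
      cong (ℚ._/ 1) (sym (cong₂ ℤ._+_ (ℤₚ.*-identityʳ a) (ℤₚ.*-identityʳ b)))

    ι-* : ∀ a b → ι (a ℤ.* b) ≡ ι a * ι b
    ι-* a b rewrite ι-mkℚ a | ι-mkℚ b = refl

  ι-neg : ∀ a → ι (ℤ.- a) ≡ - ι a
  ι-neg a rewrite ι-mkℚ (ℤ.- a) | ι-mkℚ a with a
  ... | + zero     = refl
  ... | + suc _    = refl
  ... | ℤ.-[1+ _ ] = refl

  ι-injective : ∀ {a b} → ι a ≡ ι b → a ≡ b
  ι-injective {a} {b} eq rewrite ι-mkℚ a | ι-mkℚ b = cong ℚ.numerator eq

  ι-mono-≤ : ∀ {a b} → a ℤ.≤ b → ι a ≤ ι b
  ι-mono-≤ {a} {b} a≤b rewrite ι-mkℚ a | ι-mkℚ b =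
    *≤* (subst₂ ℤ._≤_ (sym (ℤₚ.*-identityʳ a)) (sym (ℤₚ.*-identityʳ b)) a≤b)

  natToℚ : ℕ → ℚ
  natToℚ n = ι (+ n)

  natToℚ-mono-≤ : ∀ {a b} → a ℕ.≤ b → natToℚ a ≤ natToℚ b
  natToℚ-mono-≤ a≤b = ι-mono-≤ (ℤ.+≤+ a≤b)

  natToℚ-+ : ∀ a b → natToℚ (a ℕ.+ b) ≡ natToℚ a + natToℚ b
  natToℚ-+ a b = ι-+ (+ a) (+ b)

  natToℚ-* : ∀ a b → natToℚ (a ℕ.* b) ≡ natToℚ a * natToℚ b
  natToℚ-* a b = trans (cong ι (ℤₚ.pos-* a b)) (ι-* (+ a) (+ b))

  0≤natToℚ : ∀ n → 0ℚ ≤ natToℚ n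
  0≤natToℚ n = subst (_≤ natToℚ n) ι-0 (natToℚ-mono-≤ ℕ.z≤n)

  1≤natToℚ : ∀ {n} → 1 ℕ.≤ n → 1ℚ ≤ natToℚ n
  1≤natToℚ {n} 1≤n = subst (_≤ natToℚ n) ι-1 (natToℚ-mono-≤ 1≤n)

  below-natToℚ : ∀ r → ∃[ n ] r < natToℚ n
  below-natToℚ r@(mkℚ p d _) = suc ℤ.∣ p ∣ , lt
    where
    lt : r < natToℚ (suc ℤ.∣ p ∣)
    lt rewrite ι-mkℚ (+ suc ℤ.∣ p ∣) = *<* (begin-strict
      p ℤ.* + 1                        ≡⟨ ℤₚ.*-identityʳ p ⟩
      p                                ≤⟨ p≤∣p∣ p ⟩
      + ℤ.∣ p ∣                        <⟨ ℤ.+<+ (ℕₚ.n<1+n _) ⟩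
      + suc ℤ.∣ p ∣                    ≤⟨ ℤ.+≤+ (ℕₚ.m≤m*n (suc ℤ.∣ p ∣) (suc d)) ⟩
      + (suc ℤ.∣ p ∣ ℕ.* suc d)        ≡⟨ ℤₚ.pos-* (suc ℤ.∣ p ∣) (suc d) ⟩
      + suc ℤ.∣ p ∣ ℤ.* + suc d        ∎)
      where
      open ℤₚ.≤-Reasoning
      p≤∣p∣ : ∀ p → p ℤ.≤ + ℤ.∣ p ∣
      p≤∣p∣ (+ _)       = ℤₚ.≤-refl
      p≤∣p∣ ℤ.-[1+ _ ] = ℤ.-≤+

  *-mono-≤-nonNeg : ∀ {a b c d} → 0ℚ ≤ a → 0ℚ ≤ d → a ≤ b → c ≤ d → a * c ≤ b * d
  *-mono-≤-nonNeg {a} {b} {c} {d} 0≤a 0≤d a≤b c≤d = ≤-trans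
    (*-monoˡ-≤-nonNeg a {{nonNegative 0≤a}} c≤d)
    (*-monoʳ-≤-nonNeg d {{nonNegative 0≤d}} a≤b)

  0≤-* : ∀ {a b} → 0ℚ ≤ a → 0ℚ ≤ b → 0ℚ ≤ a * b
  0≤-* {a} {b} 0≤a 0≤b =
    nonNegative⁻¹ _ {{nonNeg*nonNeg⇒nonNeg a {{nonNegative 0≤a}} b {{nonNegative 0≤b}}}}

  0<-* : ∀ {a b} → 0ℚ < a → 0ℚ < b → 0ℚ < a * b
  0<-* {a} {b} 0<a 0<b = positive⁻¹ _ {{pos*pos⇒pos a {{positive 0<a}} b {{positive 0<b}}}}

  p≤q+p : ∀ p {q} → 0ℚ ≤ q → p ≤ q + p
  p≤q+p p {q} 0≤q = subst (_≤ q + p) (+-identityˡ p) (+-monoˡ-≤ p 0≤q)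

  p≤p+q : ∀ p {q} → 0ℚ ≤ q → p ≤ p + q
  p≤p+q p {q} 0≤q = subst (_≤ p + q) (+-identityʳ p) (+-monoʳ-≤ p 0≤q)

  1/-positive : ∀ {p} → 0ℚ < p → ∃[ q ] (0ℚ < q × q * p ≡ 1ℚ)
  1/-positive {p} 0<p =
    (1/ p) {{pos⇒nonZero p}} , positive⁻¹ _ {{1/pos⇒pos p}} , *-inverseˡ p {{pos⇒nonZero p}}
    where instance _ = positive 0<p

  archimedean : ∀ {ε} K → 0ℚ < ε → ∃[ n ] K < ε * natToℚ n
  archimedean {ε} K 0<ε with 1/-positive 0<ε
  ... | q , 0<q , q*ε≡1 with below-natToℚ (K * q)
  ...   | n , Kq<n = n , (begin-strict
    K            ≡⟨ *-identityʳ K ⟨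
    K * 1ℚ       ≡⟨ cong (K *_) q*ε≡1 ⟨
    K * (q * ε)  ≡⟨ solve 3 (λ K q ε → K :* (q :* ε) := ε :* (K :* q)) refl K q ε ⟩
    ε * (K * q)  <⟨ *-monoʳ-<-pos ε {{positive 0<ε}} Kq<n ⟩
    ε * natToℚ n ∎)
    where open ≤-Reasoning

  -- `x ≃ᵣ y` is by definition `Null` of the termwise difference, so equality of reals enters the
  -- null-sequence calculus without conversion.
  Null : Seq → Set
  Null y = ∀ ε → 0ℚ < ε → ∃[ N ] (∀ n → N ℕ.≤ n → ∣ y n ∣ < ε)

  Bounded : Seq → Set
  Bounded y = ∃[ K ] (∀ n → ∣ y n ∣ ≤ K)

  tendsto-0⇒null : ∀ {y} → Tendsto y 0ℚ → Null y
  tendsto-0⇒null {y} lim ε 0<ε with lim ε 0<ε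
  ... | N , small = N , λ n N≤n → subst (λ t → ∣ t ∣ < ε) (+-identityʳ (y n)) (small n N≤n)

  null⇒tendsto-0 : ∀ {y} → Null y → Tendsto y 0ℚ
  null⇒tendsto-0 {y} lim ε 0<ε with lim ε 0<ε
  ... | N , small = N , λ n N≤n → subst (λ t → ∣ t ∣ < ε) (sym (+-identityʳ (y n))) (small n N≤n)

  null-cong : ∀ {x y} → (∀ n → x n ≡ y n) → Null x → Null y
  null-cong x≡y lim ε 0<ε with lim ε 0<ε
  ... | N , small = N , λ n N≤n → subst (λ t → ∣ t ∣ < ε) (x≡y n) (small n N≤n)

  null-+ : ∀ {x y} → Null x → Null y → Null (λ n → x n + y n)
  null-+ {x} {y} lim-x lim-y ε 0<ε with lim-x (½ * ε) 0<ε/2 | lim-y (½ * ε) 0<ε/2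
    where 0<ε/2 = 0<-* {½} (positive⁻¹ ½) 0<ε
  ... | M , small-x | N , small-y = M ℕ.⊔ N , λ n M⊔N≤n → begin-strict
    ∣ x n + y n ∣     ≤⟨ ∣p+q∣≤∣p∣+∣q∣ (x n) (y n) ⟩
    ∣ x n ∣ + ∣ y n ∣ <⟨ +-mono-< (small-x n (ℕₚ.≤-trans (ℕₚ.m≤m⊔n M N) M⊔N≤n))
                                  (small-y n (ℕₚ.≤-trans (ℕₚ.m≤n⊔m M N) M⊔N≤n)) ⟩
    ½ * ε + ½ * ε     ≡⟨ *-distribʳ-+ ε ½ ½ ⟨
    1ℚ * ε            ≡⟨ *-identityˡ ε ⟩
    ε                 ∎
    where open ≤-Reasoning

  null-* : ∀ {b y} → Bounded b → Null y → Null (λ n → b n * y n)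
  null-* {b} {y} (K , b≤K) lim ε 0<ε = proof
    where
    -- `K` may be 0, so the tolerance is divided by `1ℚ + K` instead.
    0<1+K : 0ℚ < 1ℚ + K
    0<1+K = +-mono-<-≤ {0ℚ} {1ℚ} {0ℚ} (positive⁻¹ 1ℚ) (≤-trans (0≤∣p∣ (b 0)) (b≤K 0))
    open ≤-Reasoning
    proof : ∃[ N ] (∀ n → N ℕ.≤ n → ∣ b n * y n ∣ < ε)
    proof with 1/-positive 0<1+K
    ... | q , 0<q , q*[1+K]≡1 with lim (q * ε) (0<-* 0<q 0<ε)
    ...   | N , small = N , λ n N≤n → begin-strict
      ∣ b n * y n ∣          ≡⟨ ∣p*q∣≡∣p∣*∣q∣ (b n) (y n) ⟩
      ∣ b n ∣ * ∣ y n ∣      ≤⟨ *-monoʳ-≤-nonNeg ∣ y n ∣ {{∣-∣-nonNeg (y n)}}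
                                  (≤-trans (b≤K n) (p≤q+p K (<⇒≤ (positive⁻¹ 1ℚ)))) ⟩
      (1ℚ + K) * ∣ y n ∣     <⟨ *-monoʳ-<-pos (1ℚ + K) {{positive 0<1+K}} (small n N≤n) ⟩
      (1ℚ + K) * (q * ε)     ≡⟨ solve 3 (λ K q ε → K :* (q :* ε) := (q :* K) :* ε) refl (1ℚ + K) q ε ⟩
      (q * (1ℚ + K)) * ε     ≡⟨ cong (_* ε) q*[1+K]≡1 ⟩
      1ℚ * ε                 ≡⟨ *-identityˡ ε ⟩
      ε                      ∎

  bounded-const : ∀ c → Bounded (λ _ → c)
  bounded-const c = ∣ c ∣ , λ _ → ≤-refl

  bounded-+ : ∀ {x y} → Bounded x → Bounded y → Bounded (λ n → x n + y n)
  bounded-+ {x} {y} (K , x≤K) (L , y≤L) =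
    K + L , λ n → ≤-trans (∣p+q∣≤∣p∣+∣q∣ (x n) (y n)) (+-mono-≤ (x≤K n) (y≤L n))

  bounded-scale : ∀ {x} c → Bounded x → Bounded (λ n → c * x n)
  bounded-scale {x} c (K , x≤K) = ∣ c ∣ * K , λ n → subst (_≤ ∣ c ∣ * K)
    (sym (∣p*q∣≡∣p∣*∣q∣ c (x n))) (*-monoˡ-≤-nonNeg ∣ c ∣ {{∣-∣-nonNeg c}} (x≤K n))

  null-scale : ∀ {y} c → Null y → Null (λ n → c * y n)
  null-scale c = null-* (bounded-const c)

  null-neg : ∀ {y} → Null y → Null (λ n → - y n)
  null-neg {y} lim ε 0<ε with lim ε 0<ε
  ... | N , small = N , λ n N≤n → subst (_< ε) (sym (∣-p∣≡∣p∣ (y n))) (small n N≤n)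

  -- The way back from limits to exact equations between rationals.
  null-const : ∀ {c} → Null (λ _ → c) → c ≡ 0ℚ
  null-const {c} lim with c ≟ 0ℚ
  ... | yes c≡0 = c≡0
  ... | no  c≢0 with lim ∣ c ∣ 0<∣c∣
    where
    0<∣c∣ : 0ℚ < ∣ c ∣
    0<∣c∣ with 0ℚ <? ∣ c ∣
    ... | yes 0<∣c∣ = 0<∣c∣
    ... | no  0≮∣c∣ =
      contradiction (∣p∣≡0⇒p≡0 c (≤-antisym (≮⇒≥ 0≮∣c∣) (0≤∣p∣ c))) c≢0
  ...   | N , small = contradiction (small N ℕₚ.≤-refl) (<-irrefl refl)

  -- Continuants and convergents

  -- The product of the matrices [[0,1],[1,a]] over the entries a of l is
  -- [[num₋ l, num l],[den₋ l, den l]].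
  num₋ num den₋ den : List ℕ → ℕ
  num₋ []      = 1
  num₋ (a ∷ l) = den₋ l
  num  []      = 0
  num  (a ∷ l) = den l
  den₋ []      = 0
  den₋ (a ∷ l) = num₋ l ℕ.+ a ℕ.* den₋ l
  den  []      = 1
  den  (a ∷ l) = num l ℕ.+ a ℕ.* den l

  -- The determinant of the matrix product: each factor [[0,1],[1,a]] has determinant -1.
  sign : List ℕ → ℤ
  sign []      = + 1
  sign (a ∷ l) = ℤ.- sign l

  pos-+-* : ∀ b a d → + (b ℕ.+ a ℕ.* d) ≡ + b ℤ.+ + a ℤ.* + d
  pos-+-* b a d = trans (ℤₚ.pos-+ b (a ℕ.* d)) (cong (λ t → + b ℤ.+ t) (ℤₚ.pos-* a d))

  determinant : ∀ l → + num₋ l ℤ.* + den l ℤ.- + num l ℤ.* + den₋ l ≡ sign l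
  determinant []      = refl
  determinant (a ∷ l) = trans
    (cong₂ (λ s t → + den₋ l ℤ.* s ℤ.- + den l ℤ.* t)
           (pos-+-* (num l) a (den l)) (pos-+-* (num₋ l) a (den₋ l)))
    (trans (swap-rows (+ num₋ l) (+ num l) (+ den₋ l) (+ den l) (+ a))
           (cong ℤ.-_ (determinant l)))
    where
    swap-rows : ∀ A B C D a → C ℤ.* (B ℤ.+ a ℤ.* D) ℤ.- D ℤ.* (A ℤ.+ a ℤ.* C)
                            ≡ ℤ.- (A ℤ.* D ℤ.- B ℤ.* C)
    swap-rows = solve-∀

  sign² : ∀ l → sign l ℤ.* sign l ≡ + 1
  sign² []      = refl
  sign² (a ∷ l) = trans (neg*neg (sign l)) (sign² l)
    where
    neg*neg : ∀ s → ℤ.- s ℤ.* ℤ.- s ≡ s ℤ.* s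
    neg*neg = solve-∀

  ∣sign∣≡1 : ∀ l → ∣ ι (sign l) ∣ ≡ 1ℚ
  ∣sign∣≡1 []      = cong ∣_∣ ι-1
  ∣sign∣≡1 (a ∷ l) rewrite ι-neg (sign l) = trans (∣-p∣≡∣p∣ (ι (sign l))) (∣sign∣≡1 l)

  1≤den : ∀ {l} → All (0 ℕ.<_) l → 1 ℕ.≤ den l
  1≤den         []          = ℕₚ.≤-refl
  1≤den {a ∷ l} (0<a ∷ 0<l) =
    ℕₚ.≤-trans (ℕₚ.*-mono-≤ 0<a (1≤den 0<l)) (ℕₚ.m≤n+m (a ℕ.* den l) (num l))

  -- With a nonempty tail `l`, `num l` is itself a denominator and hence at least 1, so each new
  -- entry raises `den` by at least 1. As `num []` is 0, the singleton is treated apart.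
  length≤den : ∀ {l} → All (0 ℕ.<_) l → length l ℕ.≤ den l
  length≤den []                             = ℕ.z≤n
  length≤den (0<a ∷ [])                     = 1≤den (0<a ∷ [])
  length≤den {a ∷ l} (0<a ∷ 0<l@(_ ∷ 0<l′)) =
    ℕₚ.+-mono-≤ (1≤den 0<l′)
      (ℕₚ.≤-trans (length≤den 0<l) (ℕₚ.m≤n*m (den l) a {{ℕ.>-nonZero 0<a}}))

  -- Right multiplication by [[0,1],[1,a]] moves the second column into the first. The continuants
  -- recurse at the front of the list, whereas reversal appends at the back.
  num₋-∷ʳ : ∀ l a → num₋ (l ∷ʳ a) ≡ num l
  den₋-∷ʳ : ∀ l a → den₋ (l ∷ʳ a) ≡ den l
  num₋-∷ʳ []      a = refl
  num₋-∷ʳ (b ∷ l) a = den₋-∷ʳ l a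
  den₋-∷ʳ []      a = cong suc (ℕₚ.*-zeroʳ a)
  den₋-∷ʳ (b ∷ l) a = cong₂ (λ s t → s ℕ.+ b ℕ.* t) (num₋-∷ʳ l a) (den₋-∷ʳ l a)

  num-∷ʳ : ∀ l a → num (l ∷ʳ a) ≡ num₋ l ℕ.+ a ℕ.* num l
  den-∷ʳ : ∀ l a → den (l ∷ʳ a) ≡ den₋ l ℕ.+ a ℕ.* den l
  num-∷ʳ []      a = cong suc (sym (ℕₚ.*-zeroʳ a))
  num-∷ʳ (b ∷ l) a = den-∷ʳ l a
  den-∷ʳ []      a = refl
  den-∷ʳ (b ∷ l) a rewrite num-∷ʳ l a | den-∷ʳ l a =
    exchange (num₋ l) (num l) (den₋ l) (den l) a b
    where
    exchange : ∀ A B C D a b → A ℕ.+ a ℕ.* B ℕ.+ b ℕ.* (C ℕ.+ a ℕ.* D)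
                             ≡ A ℕ.+ b ℕ.* C ℕ.+ a ℕ.* (B ℕ.+ b ℕ.* D)
    exchange = ℕ-RingSolver.solve-∀

  -- The factors [[0,1],[1,a]] are symmetric, so reversal transposes the product.
  num-reverse  : ∀ l → num (reverse l) ≡ den₋ l
  den-reverse  : ∀ l → den (reverse l) ≡ den l
  num₋-reverse : ∀ l → num₋ (reverse l) ≡ num₋ l
  den₋-reverse : ∀ l → den₋ (reverse l) ≡ num l
  num-reverse [] = refl
  num-reverse (a ∷ l) rewrite unfold-reverse a l | num-∷ʳ (reverse l) a =
    cong₂ (λ s t → s ℕ.+ a ℕ.* t) (num₋-reverse l) (num-reverse l)
  den-reverse [] = refl
  den-reverse (a ∷ l) rewrite unfold-reverse a l | den-∷ʳ (reverse l) a =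
    cong₂ (λ s t → s ℕ.+ a ℕ.* t) (den₋-reverse l) (den-reverse l)
  num₋-reverse [] = refl
  num₋-reverse (a ∷ l) rewrite unfold-reverse a l =
    trans (num₋-∷ʳ (reverse l) a) (num-reverse l)
  den₋-reverse [] = refl
  den₋-reverse (a ∷ l) rewrite unfold-reverse a l =
    trans (den₋-∷ʳ (reverse l) a) (den-reverse l)

  -- Palindromes and symmetric matrices

  tabulate-∷ʳ : ∀ {n} (f : Fin (suc n) → ℕ) →
                tabulate f ≡ tabulate (f ∘ inject₁) ∷ʳ f (fromℕ n)
  tabulate-∷ʳ {zero}  f = refl
  tabulate-∷ʳ {suc n} f = cong (f zero ∷_) (tabulate-∷ʳ (f ∘ suc))

  -- `opposite` sends `zero` to `fromℕ n` and `suc i` to `inject₁ (opposite i)`: the head is the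
  -- last value of `f`, and the induction continues with `f` deprived of that value.
  tabulate-opposite : ∀ {n} (f : Fin n → ℕ) → tabulate (f ∘ opposite) ≡ reverse (tabulate f)
  tabulate-opposite {zero}  f = refl
  tabulate-opposite {suc n} f = begin
    f (fromℕ n) ∷ tabulate (f ∘ inject₁ ∘ opposite)
      ≡⟨ cong (f (fromℕ n) ∷_) (tabulate-opposite (f ∘ inject₁)) ⟩
    f (fromℕ n) ∷ reverse (tabulate (f ∘ inject₁))
      ≡⟨ reverse-++ (tabulate (f ∘ inject₁)) (f (fromℕ n) ∷ []) ⟨
    reverse (tabulate (f ∘ inject₁) ∷ʳ f (fromℕ n))
      ≡⟨ cong reverse (tabulate-∷ʳ f) ⟨
    reverse (tabulate f) ∎
    where open ≡-Reasoning

  palindrome⇒reverse : ∀ l → (∀ i → lookup l i ≡ lookup l (opposite i)) → reverse l ≡ l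
  palindrome⇒reverse l pal = begin
    reverse l                             ≡⟨ cong reverse (tabulate-lookup l) ⟨
    reverse (tabulate (lookup l))         ≡⟨ tabulate-opposite (lookup l) ⟨
    tabulate (lookup l ∘ opposite)        ≡⟨ tabulate-cong pal ⟨
    tabulate (lookup l)                   ≡⟨ tabulate-lookup l ⟩
    l                                     ∎
    where open ≡-Reasoning

  palindrome-num : ∀ l → (∀ i → lookup l i ≡ lookup l (opposite i)) → den₋ l ≡ num l
  palindrome-num l pal = trans (sym (num-reverse l)) (cong num (palindrome⇒reverse l pal))

  -- Values of finite continued fractions

  inv-positive : ∀ {t} → 0ℚ < t → 0ℚ < inv t × inv t * t ≡ 1ℚ
  inv-positive {t} 0<t with t ≟ 0ℚ
  ... | yes t≡0 = contradiction (sym t≡0) (<⇒≢ 0<t)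
  ... | no  t≢0 = positive⁻¹ _ {{1/pos⇒pos t}} , *-inverseˡ t {{ℚ.≢-nonZero t≢0}}
    where instance _ = positive 0<t

  0<1ℚ : 0ℚ < 1ℚ
  0<1ℚ = positive⁻¹ 1ℚ

  1≤natToℚ+ : ∀ {a y} → 0 ℕ.< a → 0ℚ ≤ y → 1ℚ ≤ natToℚ a + y
  1≤natToℚ+ {a} {y} 0<a 0≤y = ≤-trans (1≤natToℚ 0<a) (p≤p+q (natToℚ a) 0≤y)

  -- Mutual, because the junk value of `inv` is excluded only once the tail is known to be
  -- nonnegative. The recursion x = 1/(a + y) is recorded as a product, so that later computations
  -- are ring identities.
  0≤cf0   : ∀ {l} → All (0 ℕ.<_) l → 0ℚ ≤ cf0 l
  cf0-∷   : ∀ {a l} → All (0 ℕ.<_) (a ∷ l) →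
            0ℚ < cf0 (a ∷ l) × cf0 (a ∷ l) * (natToℚ a + cf0 l) ≡ 1ℚ
  0≤cf0 []           = ≤-refl
  0≤cf0 (0<a ∷ 0<l)  = <⇒≤ (proj₁ (cf0-∷ (0<a ∷ 0<l)))
  cf0-∷ {a} {l} (0<a ∷ 0<l) = subst (λ t → 0ℚ < inv (t + y) × inv (t + y) * (natToℚ a + y) ≡ 1ℚ)
    (ι≡intToℚ (+ a)) (inv-positive (<-≤-trans 0<1ℚ (1≤natToℚ+ 0<a (0≤cf0 0<l))))
    where y = cf0 l

  cf0≤1 : ∀ {l} → All (0 ℕ.<_) l → cf0 l ≤ 1ℚ
  cf0≤1 []                    = <⇒≤ 0<1ℚ
  cf0≤1 {a ∷ l} (0<a ∷ 0<l) with cf0-∷ (0<a ∷ 0<l)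
  ... | 0<x , x[a+y]≡1 = begin
    cf0 (a ∷ l)                       ≡⟨ *-identityʳ (cf0 (a ∷ l)) ⟨
    cf0 (a ∷ l) * 1ℚ                  ≤⟨ *-monoˡ-≤-nonNeg (cf0 (a ∷ l)) {{nonNegative (<⇒≤ 0<x)}}
                                           (1≤natToℚ+ 0<a (0≤cf0 0<l)) ⟩
    cf0 (a ∷ l) * (natToℚ a + cf0 l)  ≡⟨ x[a+y]≡1 ⟩
    1ℚ                                ∎
    where open ≤-Reasoning

  möbius-step : ∀ X a Y A B C D x → X * (a + Y) ≡ 1ℚ → Y * (C * x + D) ≡ A * x + B →
                X * ((A + a * C) * x + (B + a * D)) ≡ C * x + D
  möbius-step X a Y A B C D x X[a+Y]≡1 Y-eq = begin
    X * ((A + a * C) * x + (B + a * D))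
      ≡⟨ solve 7 (λ X a A B C D x → X :* ((A :+ a :* C) :* x :+ (B :+ a :* D))
                                 := X :* ((A :* x :+ B) :+ a :* (C :* x :+ D))) refl X a A B C D x ⟩
    X * ((A * x + B) + a * (C * x + D))
      ≡⟨ cong (λ t → X * (t + a * (C * x + D))) Y-eq ⟨
    X * (Y * (C * x + D) + a * (C * x + D))
      ≡⟨ solve 4 (λ X a Y t → X :* (Y :* t :+ a :* t) := (X :* (a :+ Y)) :* t) refl X a Y (C * x + D) ⟩
    (X * (a + Y)) * (C * x + D)
      ≡⟨ cong (_* (C * x + D)) X[a+Y]≡1 ⟩
    1ℚ * (C * x + D)
      ≡⟨ *-identityˡ (C * x + D) ⟩
    C * x + D ∎
    where open ≡-Reasoning

  natToℚ-+-* : ∀ b a d → natToℚ (b ℕ.+ a ℕ.* d) ≡ natToℚ b + natToℚ a * natToℚ d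
  natToℚ-+-* b a d = trans (natToℚ-+ b (a ℕ.* d)) (cong (λ t → natToℚ b + t) (natToℚ-* a d))

  -- The matrix of `l` acts on the value of the tail as a Möbius map; the identity is that action
  -- with its denominator cleared.
  cf0-++ : ∀ l {r} → All (0 ℕ.<_) (l ++ r) →
           cf0 (l ++ r) * (natToℚ (den₋ l) * cf0 r + natToℚ (den l))
             ≡ natToℚ (num₋ l) * cf0 r + natToℚ (num l)
  cf0-++ [] {r} _ rewrite ι-0 | ι-1 =
    solve 1 (λ x → x :* (con 0ℚ :* x :+ con 1ℚ) := con 1ℚ :* x :+ con 0ℚ) refl (cf0 r)
  cf0-++ (a ∷ l) {r} (0<a ∷ 0<l)
    rewrite natToℚ-+-* (num₋ l) a (den₋ l) | natToℚ-+-* (num l) a (den l) =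
    möbius-step (cf0 (a ∷ l ++ r)) (natToℚ a) (cf0 (l ++ r))
      (natToℚ (num₋ l)) (natToℚ (num l)) (natToℚ (den₋ l)) (natToℚ (den l)) (cf0 r)
      (proj₂ (cf0-∷ (0<a ∷ 0<l))) (cf0-++ l 0<l)

  -- Over a common denominator the terms in x y and the constant terms cancel, leaving the
  -- determinant times x - y.
  möbius-difference : ∀ X Y A B C D x y e → X * (C * x + D) ≡ A * x + B →
    Y * (C * y + D) ≡ A * y + B → A * D - B * C ≡ e →
    (X - Y) * ((C * x + D) * (C * y + D)) ≡ e * (x - y)
  möbius-difference X Y A B C D x y e X-eq Y-eq det = begin
    (X - Y) * (s * t)
      ≡⟨ solve 4 (λ X Y s t → (X :- Y) :* (s :* t) := X :* s :* t :- Y :* t :* s) refl X Y s t ⟩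
    X * s * t - Y * t * s
      ≡⟨ cong₂ (λ u v → u * t - v * s) X-eq Y-eq ⟩
    (A * x + B) * t - (A * y + B) * s
      ≡⟨ solve 6 (λ A B C D x y →
           (A :* x :+ B) :* (C :* y :+ D) :- (A :* y :+ B) :* (C :* x :+ D)
             := (A :* D :- B :* C) :* (x :- y)) refl A B C D x y ⟩
    (A * D - B * C) * (x - y)
      ≡⟨ cong (_* (x - y)) det ⟩
    e * (x - y) ∎
    where
    open ≡-Reasoning
    s = C * x + D
    t = C * y + D

  ∣x-y∣≤1 : ∀ {x y} → 0ℚ ≤ x → x ≤ 1ℚ → 0ℚ ≤ y → y ≤ 1ℚ → ∣ x - y ∣ ≤ 1ℚ
  ∣x-y∣≤1 {x} {y} 0≤x x≤1 0≤y y≤1 with ∣p∣≡p∨∣p∣≡-p (x - y)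
  ... | inj₁ eq rewrite eq = +-mono-≤ x≤1 (neg-antimono-≤ 0≤y)
  ... | inj₂ eq rewrite eq = subst (_≤ 1ℚ) (sym (solve 2 (λ x y → :- (x :- y) := y :- x) refl x y))
                               (+-mono-≤ y≤1 (neg-antimono-≤ 0≤x))

  -- The determinant gives the bound 1 / q² with q = den l, weakened using q ≥ 1 and q ≥ length l.
  cf0-common-prefix : ∀ l {r s} → All (0 ℕ.<_) (l ++ r) → All (0 ℕ.<_) (l ++ s) →
                      ∣ cf0 (l ++ r) - cf0 (l ++ s) ∣ * natToℚ (length l) ≤ 1ℚ
  cf0-common-prefix l {r} {s} 0<lr 0<ls = begin
    ∣ X - Y ∣ * natToℚ (length l)
      ≤⟨ *-monoˡ-≤-nonNeg ∣ X - Y ∣ {{∣-∣-nonNeg (X - Y)}} length≤u*v ⟩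
    ∣ X - Y ∣ * (u * v)
      ≡⟨ cong (∣ X - Y ∣ *_) (0≤p⇒∣p∣≡p (0≤-* (≤-trans 0≤D D≤u) (≤-trans 0≤D D≤v))) ⟨
    ∣ X - Y ∣ * ∣ u * v ∣
      ≡⟨ ∣p*q∣≡∣p∣*∣q∣ (X - Y) (u * v) ⟨
    ∣ (X - Y) * (u * v) ∣
      ≡⟨ cong ∣_∣ (möbius-difference X Y A B C D x y (ι (sign l))
                     (cf0-++ l 0<lr) (cf0-++ l 0<ls) det) ⟩
    ∣ ι (sign l) * (x - y) ∣
      ≡⟨ ∣p*q∣≡∣p∣*∣q∣ (ι (sign l)) (x - y) ⟩
    ∣ ι (sign l) ∣ * ∣ x - y ∣
      ≡⟨ cong (_* ∣ x - y ∣) (∣sign∣≡1 l) ⟩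
    1ℚ * ∣ x - y ∣
      ≡⟨ *-identityˡ ∣ x - y ∣ ⟩
    ∣ x - y ∣
      ≤⟨ ∣x-y∣≤1 (0≤cf0 0<r) (cf0≤1 0<r) (0≤cf0 0<s) (cf0≤1 0<s) ⟩
    1ℚ ∎
    where
    open ≤-Reasoning
    X = cf0 (l ++ r)
    Y = cf0 (l ++ s)
    x = cf0 r
    y = cf0 s
    A = natToℚ (num₋ l)
    B = natToℚ (num l)
    C = natToℚ (den₋ l)
    D = natToℚ (den l)
    u = C * x + D
    v = C * y + D
    0<r = ++⁻ʳ l 0<lr
    0<s = ++⁻ʳ l 0<ls
    0<l = ++⁻ˡ l 0<lr
    0≤D = 0≤natToℚ (den l)
    D≤u : D ≤ u
    D≤u = p≤q+p D (0≤-* (0≤natToℚ (den₋ l)) (0≤cf0 0<r))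
    D≤v : D ≤ v
    D≤v = p≤q+p D (0≤-* (0≤natToℚ (den₋ l)) (0≤cf0 0<s))
    length≤u*v : natToℚ (length l) ≤ u * v
    length≤u*v = subst (_≤ u * v) (*-identityʳ (natToℚ (length l)))
      (*-mono-≤-nonNeg (0≤natToℚ (length l)) (≤-trans 0≤D D≤v)
        (≤-trans (natToℚ-mono-≤ (length≤den 0<l)) D≤u)
        (≤-trans (1≤natToℚ (1≤den 0<l)) D≤v))
    det : A * D - B * C ≡ ι (sign l)
    det = begin-equality
      A * D - B * C
        ≡⟨ cong₂ _-_ (ι-* (+ num₋ l) (+ den l)) (ι-* (+ num l) (+ den₋ l)) ⟨
      ι (+ num₋ l ℤ.* + den l) - ι (+ num l ℤ.* + den₋ l)
        ≡⟨ cong (λ t → ι (+ num₋ l ℤ.* + den l) + t) (ι-neg (+ num l ℤ.* + den₋ l)) ⟨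
      ι (+ num₋ l ℤ.* + den l) + ι (ℤ.- (+ num l ℤ.* + den₋ l))
        ≡⟨ ι-+ (+ num₋ l ℤ.* + den l) (ℤ.- (+ num l ℤ.* + den₋ l)) ⟨
      ι (+ num₋ l ℤ.* + den l ℤ.- + num l ℤ.* + den₋ l)
        ≡⟨ cong ι (determinant l) ⟩
      ι (sign l) ∎

  -- Periodic continued fractions

  take-++-≤ : ∀ {n} (xs ys : List ℕ) → n ℕ.≤ length xs → take n (xs ++ ys) ≡ take n xs
  take-++-≤ {zero}  xs       ys _           = refl
  take-++-≤ {suc n} (x ∷ xs) ys (ℕ.s≤s n≤l) = cong (x ∷_) (take-++-≤ xs ys n≤l)

  take-length-+ : ∀ n (xs ys : List ℕ) → take (length xs ℕ.+ n) (xs ++ ys) ≡ xs ++ take n ys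
  take-length-+ n []       ys = refl
  take-length-+ n (x ∷ xs) ys = cong (x ∷_) (take-length-+ n xs ys)

  repeatList-+ : ∀ m n l → repeatList (m ℕ.+ n) l ≡ repeatList m l ++ repeatList n l
  repeatList-+ zero    n l = refl
  repeatList-+ (suc m) n l =
    trans (cong (l ++_) (repeatList-+ m n l)) (sym (++-assoc l (repeatList m l) (repeatList n l)))

  n≤length-repeatList : ∀ n {l} → 1 ℕ.≤ length l → n ℕ.≤ length (repeatList n l)
  n≤length-repeatList zero    1≤l = ℕ.z≤n
  n≤length-repeatList (suc n) {l} 1≤l rewrite length-++ l {repeatList n l} =
    ℕₚ.+-mono-≤ 1≤l (n≤length-repeatList n 1≤l)

  repeatList-positive : ∀ n {l} → All (0 ℕ.<_) l → All (0 ℕ.<_) (repeatList n l)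
  repeatList-positive zero    0<l = []
  repeatList-positive (suc n) 0<l = ++⁺ 0<l (repeatList-positive n 0<l)

  period-prefix : ℕ → List ℕ → List ℕ
  period-prefix n l = take n (repeatList n l)

  period-prefix-positive : ∀ n {l} → All (0 ℕ.<_) l → All (0 ℕ.<_) (period-prefix n l)
  period-prefix-positive n 0<l = take⁺ n (repeatList-positive n 0<l)

  -- `periodicCF` uses a different number of copies at each index. This is harmless: `n` copies of a
  -- nonempty block already have `n` entries, and further copies only extend the list.
  take-repeatList : ∀ {m n l} → 1 ℕ.≤ length l → n ℕ.≤ m →
                    take n (repeatList m l) ≡ period-prefix n l
  take-repeatList {m} {n} {l} 1≤l n≤m = begin
    take n (repeatList m l)
      ≡⟨ cong (λ k → take n (repeatList k l)) (ℕₚ.m+[n∸m]≡n n≤m) ⟨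
    take n (repeatList (n ℕ.+ (m ℕ.∸ n)) l)
      ≡⟨ cong (take n) (repeatList-+ n (m ℕ.∸ n) l) ⟩
    take n (repeatList n l ++ repeatList (m ℕ.∸ n) l)
      ≡⟨ take-++-≤ (repeatList n l) _ (n≤length-repeatList n 1≤l) ⟩
    period-prefix n l ∎
    where open ≡-Reasoning

  period-prefix-split : ∀ {m n l} → 1 ℕ.≤ length l → n ℕ.≤ m →
    period-prefix m l ≡ period-prefix n l ++ drop n (period-prefix m l)
  period-prefix-split {m} {n} {l} 1≤l n≤m = begin
    period-prefix m l
      ≡⟨ take++drop≡id n (period-prefix m l) ⟨
    take n (take m (repeatList m l)) ++ drop n (period-prefix m l)
      ≡⟨ cong (_++ drop n (period-prefix m l)) (take-take n m (repeatList m l)) ⟩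
    take (n ℕ.⊓ m) (repeatList m l) ++ drop n (period-prefix m l)
      ≡⟨ cong (λ k → take k (repeatList m l) ++ drop n (period-prefix m l)) (ℕₚ.m≤n⇒m⊓n≡m n≤m) ⟩
    take n (repeatList m l) ++ drop n (period-prefix m l)
      ≡⟨ cong (_++ drop n (period-prefix m l)) (take-repeatList 1≤l n≤m) ⟩
    period-prefix n l ++ drop n (period-prefix m l) ∎
    where open ≡-Reasoning

  -- The finite form of α = [0; l, α]: removing one whole period lowers the index by `length l`.
  period-prefix-shift : ∀ n {l} → 1 ℕ.≤ length l →
                        period-prefix (length l ℕ.+ n) l ≡ l ++ period-prefix n l
  period-prefix-shift n {l@(a ∷ l′)} 1≤l =
    trans (take-length-+ n l (repeatList (length l′ ℕ.+ n) l))
          (cong (l ++_) (take-repeatList {l = l} 1≤l (ℕₚ.m≤n+m n (length l′))))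

  length-period-prefix : ∀ n {l} → 1 ℕ.≤ length l → length (period-prefix n l) ≡ n
  length-period-prefix n {l} 1≤l =
    trans (length-take n (repeatList n l)) (ℕₚ.m≤n⇒m⊓n≡m (n≤length-repeatList n 1≤l))

  periodicCF-rate : ∀ {l} → 1 ℕ.≤ length l → All (0 ℕ.<_) l → ∀ {N m n} → N ℕ.≤ m → N ℕ.≤ n →
                    ∣ periodicCF l m - periodicCF l n ∣ * natToℚ N ≤ 1ℚ
  periodicCF-rate {l} 1≤l 0<l {N} {m} {n} N≤m N≤n = subst₂
    (λ X Y → ∣ X - Y ∣ * natToℚ N ≤ 1ℚ)
    (cong cf0 (sym m-split)) (cong cf0 (sym n-split))
    (subst (λ k → ∣ cf0 (u ++ v) - cf0 (u ++ w) ∣ * natToℚ k ≤ 1ℚ) (length-period-prefix N 1≤l)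
      (cf0-common-prefix u
        (subst (All (0 ℕ.<_)) m-split (period-prefix-positive m 0<l))
        (subst (All (0 ℕ.<_)) n-split (period-prefix-positive n 0<l))))
    where
    u = period-prefix N l
    v = drop N (period-prefix m l)
    w = drop N (period-prefix n l)
    m-split = period-prefix-split {m} {N} 1≤l N≤m
    n-split = period-prefix-split {n} {N} 1≤l N≤n

  *-cancel-≤-< : ∀ {p q r K} → 0ℚ ≤ r → p * r ≤ K → K < q * r → p < q
  *-cancel-≤-< {r = r} 0≤r pr≤K K<qr =
    *-cancelʳ-<-nonNeg r {{nonNegative 0≤r}} (≤-<-trans pr≤K K<qr)

  rate⇒cauchy : ∀ {x : Seq} →
    (∀ N m n → N ℕ.≤ m → N ℕ.≤ n → ∣ x m - x n ∣ * natToℚ N ≤ 1ℚ) → IsCauchy x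
  rate⇒cauchy rate ε 0<ε = let N , 1<εN = archimedean 1ℚ 0<ε in N , λ m n N≤m N≤n →
    *-cancel-≤-< (0≤natToℚ N) (rate N m n N≤m N≤n) 1<εN

  periodicCF-cauchy : ∀ {l} → 1 ℕ.≤ length l → All (0 ℕ.<_) l → IsCauchy (periodicCF l)
  periodicCF-cauchy {l} 1≤l 0<l =
    rate⇒cauchy {periodicCF l} (λ N m n → periodicCF-rate 1≤l 0<l {N} {m} {n})

  periodicCF-bounded : ∀ {l} → All (0 ℕ.<_) l → Bounded (periodicCF l)
  periodicCF-bounded {l} 0<l = 1ℚ , λ n → subst (_≤ 1ℚ)
    (sym (0≤p⇒∣p∣≡p (0≤cf0 (period-prefix-positive n 0<l))))
    (cf0≤1 (period-prefix-positive n 0<l))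

  -- The tail is at most 1, whence δ = 1/(a + 1). Positivity of the limit requires a bound that does
  -- not depend on `r`.
  cf0-lower : ∀ a → ∃[ δ ] (0ℚ < δ × (∀ r → All (0 ℕ.<_) (a ∷ r) → δ ≤ cf0 (a ∷ r)))
  cf0-lower a = δ , proj₁ (proj₂ inverse) , bound
    where
    0<a+1 : 0ℚ < natToℚ a + 1ℚ
    0<a+1 = +-mono-≤-< {0ℚ} {natToℚ a} {0ℚ} (0≤natToℚ a) 0<1ℚ
    inverse = 1/-positive 0<a+1
    δ = proj₁ inverse
    bound : ∀ r → All (0 ℕ.<_) (a ∷ r) → δ ≤ cf0 (a ∷ r)
    bound r 0<ar@(_ ∷ 0<r) with cf0-∷ 0<ar
    ... | 0<x , x[a+y]≡1 = *-cancelʳ-≤-pos (natToℚ a + 1ℚ) {{positive 0<a+1}} (begin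
      δ * (natToℚ a + 1ℚ)              ≡⟨ proj₂ (proj₂ inverse) ⟩
      1ℚ                               ≡⟨ x[a+y]≡1 ⟨
      cf0 (a ∷ r) * (natToℚ a + cf0 r) ≤⟨ *-monoˡ-≤-nonNeg (cf0 (a ∷ r)) {{nonNegative (<⇒≤ 0<x)}}
                                            (+-monoʳ-≤ (natToℚ a) (cf0≤1 0<r)) ⟩
      cf0 (a ∷ r) * (natToℚ a + 1ℚ)    ∎)
      where open ≤-Reasoning

  -- From x (a + y) = 1 with a ≥ 1 and y ≥ β follows x + x β ≤ 1, and x ≥ α. One entry would not
  -- suffice, since [0; 1] = 1.
  cf0-upper : ∀ a b → ∃[ δ ] (0ℚ < δ ×
              (∀ r → All (0 ℕ.<_) (a ∷ b ∷ r) → cf0 (a ∷ b ∷ r) + δ ≤ 1ℚ))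
  cf0-upper a b with cf0-lower a | cf0-lower b
  ... | α , 0<α , α≤ | β , 0<β , β≤ = α * β , 0<-* 0<α 0<β , bound
    where
    bound : ∀ r → All (0 ℕ.<_) (a ∷ b ∷ r) → cf0 (a ∷ b ∷ r) + α * β ≤ 1ℚ
    bound r 0<abr@(0<a ∷ 0<br) with cf0-∷ 0<abr
    ... | 0<x , x[a+y]≡1 = begin
      x + α * β                        ≤⟨ +-monoʳ-≤ x (*-monoʳ-≤-nonNeg β {{nonNegative (<⇒≤ 0<β)}}
                                            (α≤ (b ∷ r) 0<abr)) ⟩
      x + x * β                        ≡⟨ cong (_+ x * β) (*-identityʳ x) ⟨
      x * 1ℚ + x * β                   ≡⟨ *-distribˡ-+ x 1ℚ β ⟨
      x * (1ℚ + β)                     ≤⟨ *-monoˡ-≤-nonNeg x {{nonNegative (<⇒≤ 0<x)}}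
                                            (+-mono-≤ (1≤natToℚ 0<a) (β≤ r 0<br)) ⟩
      x * (natToℚ a + cf0 (b ∷ r))     ≡⟨ x[a+y]≡1 ⟩
      1ℚ                               ∎
      where
      open ≤-Reasoning
      x = cf0 (a ∷ b ∷ r)

  periodicCF-positive : ∀ {l} → 1 ℕ.≤ length l → All (0 ℕ.<_) l → Positive (periodicCF l)
  periodicCF-positive {a ∷ l} _ 0<l with cf0-lower a
  -- The convergent of index 0 is the empty fraction 0, so the bound starts at index 1.
  ... | δ , 0<δ , δ≤ = δ , 0<δ , 1 , λ
    { (suc n) _ → δ≤ _ (period-prefix-positive (suc n) 0<l) }

  periodicCF-<1 : ∀ {l} → 2 ℕ.≤ length l → All (0 ℕ.<_) l → LessThanOne (periodicCF l)
  periodicCF-<1 {a ∷ b ∷ l} _ 0<l with cf0-upper a b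
  -- The convergent of index 1 is 1/a, which may equal 1, so the bound starts at index 2.
  ... | δ , 0<δ , ≤1 = δ , 0<δ , 2 , λ
    { (suc (suc n)) _ → ≤1 _ (period-prefix-positive (suc (suc n)) 0<l)
    ; (suc zero) (ℕ.s≤s ()) }
  periodicCF-<1 {a ∷ []} (ℕ.s≤s ())

  -- Rational approximations of roots of monic integer quadratics

  -- The minus sign makes `c` the quotient (A + B m)/D.
  quadratic : ℤ → ℤ → ℚ → ℚ
  quadratic b c t = t * t + ι b * t - ι c

  *-denominator : ∀ p d .(cop : Coprimality.Coprime ℤ.∣ p ∣ (suc d)) →
                  mkℚ p d cop * natToℚ (suc d) ≡ ι p
  *-denominator p d cop rewrite ι-mkℚ (+ suc d) =
    trans (fromℚᵘ-cong {ℚᵘ.mkℚᵘ (p ℤ.* + suc d) (d ℕ.* 1)} {ℚᵘ.mkℚᵘ p 0} (ℚᵘ.*≡* eq))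
          (sym (ι≡intToℚ p))
    where
    eq : p ℤ.* + suc d ℤ.* + 1 ≡ p ℤ.* + suc (d ℕ.* 1)
    eq rewrite ℕₚ.*-identityʳ d = ℤₚ.*-identityʳ (p ℤ.* + suc d)

  -- Arranged so that q visibly divides p².
  quadratic-clear-denominator : ∀ b c p q r → r * ι q ≡ ι p → quadratic b c r ≡ 0ℚ →
                                p ℤ.* p ≡ q ℤ.* (c ℤ.* q ℤ.- b ℤ.* p)
  quadratic-clear-denominator b c p q r rq≡p root = begin
    p ℤ.* p
      ≡⟨ isolate p q b c ⟩
    (p ℤ.* p ℤ.+ (b ℤ.* p ℤ.* q ℤ.+ ℤ.- (c ℤ.* q ℤ.* q))) ℤ.+ q ℤ.* (c ℤ.* q ℤ.- b ℤ.* p)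
      ≡⟨ cong (λ t → t ℤ.+ q ℤ.* (c ℤ.* q ℤ.- b ℤ.* p)) (ι-injective homogeneous) ⟩
    + 0 ℤ.+ q ℤ.* (c ℤ.* q ℤ.- b ℤ.* p)
      ≡⟨ ℤₚ.+-identityˡ _ ⟩
    q ℤ.* (c ℤ.* q ℤ.- b ℤ.* p) ∎
    where
    open ≡-Reasoning
    isolate : ∀ p q b c → p ℤ.* p ≡
      (p ℤ.* p ℤ.+ (b ℤ.* p ℤ.* q ℤ.+ ℤ.- (c ℤ.* q ℤ.* q))) ℤ.+ q ℤ.* (c ℤ.* q ℤ.- b ℤ.* p)
    isolate = solve-∀
    P = ι p
    Q = ι q
    homogeneous : ι (p ℤ.* p ℤ.+ (b ℤ.* p ℤ.* q ℤ.+ ℤ.- (c ℤ.* q ℤ.* q))) ≡ ι (+ 0)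
    homogeneous = begin
      ι (p ℤ.* p ℤ.+ (b ℤ.* p ℤ.* q ℤ.+ ℤ.- (c ℤ.* q ℤ.* q)))
        ≡⟨ ι-+ (p ℤ.* p) (b ℤ.* p ℤ.* q ℤ.+ ℤ.- (c ℤ.* q ℤ.* q)) ⟩
      ι (p ℤ.* p) + ι (b ℤ.* p ℤ.* q ℤ.+ ℤ.- (c ℤ.* q ℤ.* q))
        ≡⟨ cong₂ _+_ (ι-* p p) (trans (ι-+ (b ℤ.* p ℤ.* q) (ℤ.- (c ℤ.* q ℤ.* q)))
             (cong₂ _+_ (ι-*₃ b p q)
                        (trans (ι-neg (c ℤ.* q ℤ.* q)) (cong -_ (ι-*₃ c q q))))) ⟩
      P * P + (ι b * P * Q - ι c * Q * Q)
        ≡⟨ cong (λ t → t * t + (ι b * t * Q - ι c * Q * Q)) rq≡p ⟨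
      r * Q * (r * Q) + (ι b * (r * Q) * Q - ι c * Q * Q)
        ≡⟨ solve 4 (λ r Q b c → r :* Q :* (r :* Q) :+ (b :* (r :* Q) :* Q :- c :* Q :* Q)
                             := (r :* r :+ b :* r :- c) :* (Q :* Q)) refl r Q (ι b) (ι c) ⟩
      quadratic b c r * (Q * Q)
        ≡⟨ cong (_* (Q * Q)) root ⟩
      0ℚ * (Q * Q)
        ≡⟨ *-zeroˡ (Q * Q) ⟩
      0ℚ
        ≡⟨ ι-0 ⟨
      ι (+ 0) ∎
      where
      ι-*₃ : ∀ a b c → ι (a ℤ.* b ℤ.* c) ≡ ι a * ι b * ι c
      ι-*₃ a b c = trans (ι-* (a ℤ.* b) c) (cong (_* ι c) (ι-* a b))

  -- The reduced denominator divides p · p and is coprime to p; cancelling p twice shows that it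
  -- divides 1.
  rational-root-integral : ∀ b c r → quadratic b c r ≡ 0ℚ → ∃[ j ] r ≡ ι j
  rational-root-integral b c (mkℚ p d cop) root = p , denominator-1 d cop (ℕₚ.suc-injective (ℕ.∣1⇒≡1 q∣1))
    where
    k = c ℤ.* + suc d ℤ.- b ℤ.* p
    q∣p*p : suc d ℕ.∣ ℤ.∣ p ∣ ℕ.* ℤ.∣ p ∣
    q∣p*p = subst (suc d ℕ.∣_)
      (trans (sym (ℤₚ.abs-* (+ suc d) k))
        (trans (cong ℤ.∣_∣ (sym (quadratic-clear-denominator b c p (+ suc d) (mkℚ p d cop) (*-denominator p d cop) root)))
               (ℤₚ.abs-* p p)))
      (ℕ.m∣m*n ℤ.∣ k ∣)
    coprime : Coprimality.Coprime (suc d) ℤ.∣ p ∣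
    coprime = Coprimality.sym (Coprimality.recompute cop)
    q∣1 : suc d ℕ.∣ 1
    q∣1 = Coprimality.coprime-divisor coprime
            (subst (suc d ℕ.∣_) (sym (ℕₚ.*-identityʳ ℤ.∣ p ∣)) (Coprimality.coprime-divisor coprime q∣p*p))
    denominator-1 : ∀ d .(cop : Coprimality.Coprime ℤ.∣ p ∣ (suc d)) → d ≡ 0 → mkℚ p d cop ≡ ι p
    denominator-1 zero cop refl = sym (ι-mkℚ p)

  separated-not-null : ∀ {y : Seq} {ε N} → 0ℚ < ε → (∀ n → N ℕ.≤ n → ε ≤ y n) → ¬ Null y
  separated-not-null {y} {ε} {N} 0<ε ε≤y lim with lim ε 0<ε
  ... | M , small = <⇒≱ (small n (ℕₚ.m≤m⊔n M N))
          (subst (ε ≤_) (sym (0≤p⇒∣p∣≡p (≤-trans (<⇒≤ 0<ε) ε≤yn))) ε≤yn)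
    where
    n = M ℕ.⊔ N
    ε≤yn = ε≤y n (ℕₚ.m≤n⊔m M N)
    <⇒≱ : ∀ {p q} → p < q → ¬ (q ≤ p)
    <⇒≱ p<q q≤p = <-irrefl refl (<-≤-trans p<q q≤p)

  module _ {x : Seq} (x>0 : Positive x) (x<1 : LessThanOne x) where

    -- Integers up to 0 are kept away by `x>0`, those from 1 on by `x<1`.
    not-near-integer : ∀ j → ¬ Null (λ n → x n - ι j)
    not-near-integer j lim = case j ≤0⊎1≤ of λ
      { (inj₁ j≤0) → separated-not-null (proj₁ (proj₂ x>0))
          (λ n N≤n → ≤-trans (proj₂ (proj₂ (proj₂ x>0)) n N≤n)
            (p≤p+q (x n) (neg-antimono-≤ (subst (ι j ≤_) ι-0 (ι-mono-≤ j≤0)))))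
          lim
      ; (inj₂ 1≤j) → separated-not-null (proj₁ (proj₂ x<1))
          (λ n N≤n → ε≤-[x-j] (x n) (≤-trans (proj₂ (proj₂ (proj₂ x<1)) n N≤n)
            (subst (_≤ ι j) ι-1 (ι-mono-≤ 1≤j))))
          (null-neg lim)
      }
      where
      _≤0⊎1≤ : ∀ j → j ℤ.≤ + 0 ⊎ + 1 ℤ.≤ j
      (+ zero)    ≤0⊎1≤ = inj₁ ℤₚ.≤-refl
      (+ suc n)   ≤0⊎1≤ = inj₂ (ℤ.+≤+ (ℕ.s≤s ℕ.z≤n))
      ℤ.-[1+ n ] ≤0⊎1≤ = inj₁ ℤ.-≤+
      ε≤-[x-j] : ∀ {ε j} x → x + ε ≤ j → ε ≤ - (x - j)
      ε≤-[x-j] {ε} {j} x x+ε≤j = subst₂ _≤_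
        (solve 2 (λ x ε → :- x :+ (x :+ ε) := ε) refl x ε)
        (solve 2 (λ x j → :- x :+ j := :- (x :- j)) refl x j)
        (+-monoʳ-≤ (- x) x+ε≤j)

    module _ (x-bounded : Bounded x) {b c : ℤ} (root : Null (λ n → quadratic b c (x n))) where

      -- The value of the quadratic at `r` is its value at `x n` minus (x n + r + b)(x n - r). If
      -- `x` tended to `r`, this constant would be null, hence 0, and `r` would be an integer.
      not-near-rational : ∀ r → ¬ Null (λ n → x n - r)
      not-near-rational r lim = not-near-integer (proj₁ integral)
        (null-cong (λ n → cong (λ t → x n - t) (proj₂ integral)) lim)
        where
        β = ι b
        γ = ι c
        r-root : quadratic b c r ≡ 0ℚ
        r-root = null-const (null-cong
          (λ n → solve 4 (λ x r β γ →
             x :* x :+ β :* x :- γ :+ :- ((x :+ (r :+ β)) :* (x :- r)) := r :* r :+ β :* r :- γ)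
             refl (x n) r β γ)
          (null-+ root (null-neg (null-* (bounded-+ x-bounded (bounded-const (r + β))) lim))))
        integral = rational-root-integral b c r r-root

      -- Division by `c₁` would force `x` towards the rational - c₀/c₁. This serves both to exclude
      -- degree 1 and to tell different periods apart.
      linear-not-null : ∀ c₀ c₁ → c₁ ≢ 0ℚ → ¬ Null (λ n → c₀ + x n * c₁)
      linear-not-null c₀ c₁ c₁≢0 lim = not-near-rational (- (d * c₀)) (null-cong eq (null-scale d lim))
        where
        instance _ = ℚ.≢-nonZero c₁≢0
        d = ℚ.1/ c₁
        eq : ∀ n → d * (c₀ + x n * c₁) ≡ x n - - (d * c₀)
        eq n = begin
          d * (c₀ + x n * c₁)        ≡⟨ solve 4 (λ d c₀ c₁ x → d :* (c₀ :+ x :* c₁)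
                                          := x :* (d :* c₁) :- :- (d :* c₀)) refl d c₀ c₁ (x n) ⟩
          x n * (d * c₁) - - (d * c₀) ≡⟨ cong (λ t → x n * t - - (d * c₀)) (*-inverseˡ c₁) ⟩
          x n * 1ℚ - - (d * c₀)       ≡⟨ cong (λ t → t - - (d * c₀)) (*-identityʳ (x n)) ⟩
          x n - - (d * c₀)            ∎
          where open ≡-Reasoning

      no-linear-root : ∀ p → length p ℕ.≤ 2 → NonZeroPoly p → ¬ IsRoot p x
      no-linear-root (c₀ ∷ []) _ (here c₀≢0) lim =
        c₀≢0 (null-const (null-cong
          (λ n → solve 2 (λ c₀ x → c₀ :+ x :* con 0ℚ := c₀) refl c₀ (x n))
          (tendsto-0⇒null lim)))
      no-linear-root (c₀ ∷ c₁ ∷ []) _ c≢0 lim with c₁ ≟ 0ℚ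
      ... | no c₁≢0 = linear-not-null c₀ c₁ c₁≢0 (null-cong
          (λ n → solve 3 (λ c₀ c₁ x → c₀ :+ x :* (c₁ :+ x :* con 0ℚ) := c₀ :+ x :* c₁) refl c₀ c₁ (x n))
          (tendsto-0⇒null lim))
      ... | yes refl with c≢0
      ...   | there (here 0≢0) = 0≢0 refl
      ...   | here c₀≢0 = c₀≢0 (null-const (null-cong
          (λ n → solve 2 (λ c₀ x → c₀ :+ x :* (con 0ℚ :+ x :* con 0ℚ) := c₀) refl c₀ (x n))
          (tendsto-0⇒null lim)))
      no-linear-root (_ ∷ _ ∷ _ ∷ _) (ℕ.s≤s (ℕ.s≤s ()))

      quadratic-integer : IsAlgebraicIntegerOfDegree2 x
      quadratic-integer =
        -- One polynomial witnesses both integrality and degree at most 2: the integer list with its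
        -- leading 1 maps to `monic` by computation.
        (ℤ.- c ∷ b ∷ [] , isRoot) ,
        (monic , ℕₚ.≤-refl , there (there (here 1≢0)) , isRoot) ,
        no-linear-root
        where
        monic = intToℚ (ℤ.- c) ∷ intToℚ b ∷ 1ℚ ∷ []
        isRoot : IsRoot monic x
        isRoot = null⇒tendsto-0 (null-cong
          (λ n → trans
            (solve 3 (λ x b c → x :* x :+ b :* x :- c
                             := :- c :+ x :* (b :+ x :* (con 1ℚ :+ x :* con 0ℚ)))
                   refl (x n) (ι b) (ι c))
            (cong₂ (λ s t → s + x n * (t + x n * (1ℚ + x n * 0ℚ)))
              (trans (sym (ι-neg c)) (ι≡intToℚ (ℤ.- c))) (ι≡intToℚ b)))
          root)

      -- The second quadratic is known to vanish along `y` only; subtracting (x + y + b′)(x - y)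
      -- carries it over to `x`. The squares then cancel, and the slope that remains is b - b′.
      quadratic-separates : ∀ {y b′ c′} → Bounded y → Null (λ n → quadratic b′ c′ (y n)) →
                            b ≢ b′ → ¬ (x ≃ᵣ y)
      quadratic-separates {y} {b′} {c′} y-bounded y-root b≢b′ x≃y =
        linear-not-null (γ′ - γ) (β - β′)
          (λ β-β′≡0 → b≢b′ (ι-injective (p-q≡0⇒p≡q β-β′≡0)))
          (null-cong eq
            (null-+ root (null-+ (null-neg y-root) (null-neg (null-*
              (bounded-+ x-bounded (bounded-+ y-bounded (bounded-const β′))) x≃y)))))
        where
        β = ι b
        γ = ι c
        β′ = ι b′
        γ′ = ι c′
        eq : ∀ n → quadratic b c (x n) +
                   (- quadratic b′ c′ (y n) + - ((x n + (y n + β′)) * (x n - y n)))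
                   ≡ γ′ - γ + x n * (β - β′)
        eq n = solve 6 (λ x y β γ β′ γ′ →
          (x :* x :+ β :* x :- γ) :+ (:- (y :* y :+ β′ :* y :- γ′) :+ :- ((x :+ (y :+ β′)) :* (x :- y)))
            := γ′ :- γ :+ x :* (β :- β′)) refl (x n) (y n) β γ β′ γ′
        p-q≡0⇒p≡q : ∀ {p q} → p - q ≡ 0ℚ → p ≡ q
        p-q≡0⇒p≡q {p} {q} p-q≡0 = begin
          p         ≡⟨ solve 2 (λ p q → p := p :- q :+ q) refl p q ⟩
          p - q + q ≡⟨ cong (_+ q) p-q≡0 ⟩
          0ℚ + q    ≡⟨ +-identityˡ q ⟩
          q         ∎
          where open ≡-Reasoning

  -- The quadratic satisfied by [0; as, m] repeated

  -- If X = [0; as, m + x] with matrix [[A,B],[B,D]] of as, then X is the Möbius image of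
  -- y = 1/(m + x), where β = m; the left-hand side vanishes at the fixed point X = x.
  quadratic-defect : ∀ {A B D β γ X x y} → X * (B * y + D) ≡ A * y + B → y * (β + x) ≡ 1ℚ →
    D * γ ≡ A + B * β → (B + D * (β + x)) * (x - X) ≡ D * (x * x + β * x - γ)
  quadratic-defect {A} {B} {D} {β} {γ} {X} {x} {y} X-eq y-eq γ-eq = begin
    (B + D * (β + x)) * (x - X)
      ≡⟨ solve 5 (λ B D β x X → (B :+ D :* (β :+ x)) :* (x :- X)
                  := x :* (B :+ D :* (β :+ x)) :- X :* (B :* con 1ℚ :+ D :* (β :+ x))) refl B D β x X ⟩
    x * (B + D * t) - X * (B * 1ℚ + D * t)
      ≡⟨ cong (λ e → x * (B + D * t) - X * (B * e + D * t)) y-eq ⟨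
    x * (B + D * t) - X * (B * (y * t) + D * t)
      ≡⟨ solve 6 (λ B D t x X y → x :* (B :+ D :* t) :- X :* (B :* (y :* t) :+ D :* t)
                  := x :* (B :+ D :* t) :- X :* (B :* y :+ D) :* t) refl B D t x X y ⟩
    x * (B + D * t) - X * (B * y + D) * t
      ≡⟨ cong (λ e → x * (B + D * t) - e * t) X-eq ⟩
    x * (B + D * t) - (A * y + B) * t
      ≡⟨ solve 6 (λ A B D t x y → x :* (B :+ D :* t) :- (A :* y :+ B) :* t
                  := x :* (B :+ D :* t) :- (A :* (y :* t) :+ B :* t)) refl A B D t x y ⟩
    x * (B + D * t) - (A * (y * t) + B * t)
      ≡⟨ cong (λ e → x * (B + D * t) - (A * e + B * t)) y-eq ⟩
    x * (B + D * t) - (A * 1ℚ + B * t)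
      ≡⟨ solve 5 (λ A B D β x → x :* (B :+ D :* (β :+ x)) :- (A :* con 1ℚ :+ B :* (β :+ x))
                  := D :* (x :* x :+ β :* x) :- (A :+ B :* β)) refl A B D β x ⟩
    D * (x * x + β * x) - (A + B * β)
      ≡⟨ cong (λ e → D * (x * x + β * x) - e) γ-eq ⟨
    D * (x * x + β * x) - D * γ
      ≡⟨ solve 4 (λ D β γ x → D :* (x :* x :+ β :* x) :- D :* γ
                  := D :* (x :* x :+ β :* x :- γ)) refl D β γ x ⟩
    D * (x * x + β * x - γ) ∎
    where
    open ≡-Reasoning
    t = β + x

  -- With `L` the length of the period, this is the error in the fixed-point equation.
  cauchy-shift : ∀ {x : Seq} L → IsCauchy x → Null (λ n → x n - x (L ℕ.+ n))
  cauchy-shift {x} L cauchy ε 0<ε = let N , close = cauchy ε 0<ε in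
    N , λ n N≤n → close n (L ℕ.+ n) N≤n (ℕₚ.≤-trans N≤n (ℕₚ.m≤n+m n L))

  null-cancel : ∀ {y} d → 0ℚ < d → Null (λ n → d * y n) → Null y
  null-cancel {y} d 0<d lim = let e , _ , e*d≡1 = 1/-positive 0<d in
    null-cong (λ n → trans (sym (*-assoc e d (y n))) (trans (cong (_* y n) e*d≡1) (*-identityˡ (y n))))
      (null-scale e lim)

  -- The divisibility of A + B m by D is supplied as an explicit quotient `c`, and `m` may be any
  -- positive entry for which one exists.
  module PeriodicRoot (as : List ℕ) (0<as : All (0 ℕ.<_) as) (sym-as : den₋ as ≡ num as)
    (m : ℕ) (0<m : 0 ℕ.< m) (c : ℤ)
    (c-eq : + den as ℤ.* c ≡ + num₋ as ℤ.+ + num as ℤ.* + m) where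

    l = as ∷ʳ m

    0<l : All (0 ℕ.<_) l
    0<l = ++⁺ 0<as (0<m ∷ [])

    1≤length : 1 ℕ.≤ length l
    1≤length = subst (1 ℕ.≤_) (sym (length-++ as)) (ℕₚ.m≤n+m 1 (length as))

    x = periodicCF l

    A = natToℚ (num₋ as)
    B = natToℚ (num as)
    D = natToℚ (den as)
    β = natToℚ m
    γ = ι c

    γ-eq : D * γ ≡ A + B * β
    γ-eq = begin
      D * γ                                            ≡⟨ ι-* (+ den as) c ⟨
      ι (+ den as ℤ.* c)                               ≡⟨ cong ι c-eq ⟩
      ι (+ num₋ as ℤ.+ + num as ℤ.* + m)               ≡⟨ ι-+ (+ num₋ as) (+ num as ℤ.* + m) ⟩
      A + ι (+ num as ℤ.* + m)                         ≡⟨ cong (λ t → A + t) (ι-* (+ num as) (+ m)) ⟩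
      A + B * β                                        ∎
      where open ≡-Reasoning

    defect : ∀ n → (B + D * (β + x n)) * (x n - x (length l ℕ.+ n)) ≡ D * quadratic (+ m) c (x n)
    defect n = quadratic-defect {A} {B} {D} {β} {γ} {x (length l ℕ.+ n)} {x n} {cf0 (m ∷ r)}
      -- The Möbius identity has `den₋ as` as its lower left entry; `sym-as` turns it into `num as`.
      (subst₂ (λ X b → X * (natToℚ b * cf0 (m ∷ r) + D) ≡ A * cf0 (m ∷ r) + B)
        (sym (cong cf0 (trans (period-prefix-shift n 1≤length) (++-assoc as (m ∷ []) r))))
        sym-as
        (cf0-++ as (++⁺ 0<as (0<m ∷ 0<r))))
      (proj₂ (cf0-∷ (0<m ∷ 0<r))) γ-eq
      where
      r = period-prefix n l
      0<r = period-prefix-positive n 0<l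

    isCauchy : IsCauchy x
    isCauchy = periodicCF-cauchy 1≤length 0<l

    bounded : Bounded x
    bounded = periodicCF-bounded 0<l

    root : Null (λ n → quadratic (+ m) c (x n))
    root = null-cancel D (<-≤-trans 0<1ℚ (1≤natToℚ (1≤den 0<as)))
      (null-cong defect (null-* bounded′ (cauchy-shift {x} (length l) isCauchy)))
      where
      bounded′ : Bounded (λ n → B + D * (β + x n))
      bounded′ = bounded-+ (bounded-const B) (bounded-scale D (bounded-+ (bounded-const β) bounded))

-- Arithmetic of the appended entry `w + z * k`

module _ where

  open import Data.Nat.Base as ℕ using (ℕ; zero; suc)
  import Data.Nat.Properties as ℕₚ
  open import Data.Integer.Base as ℤ using (ℤ; +_; -[1+_]; _+_; _*_; _-_; _≤_; ∣_∣)
  open import Data.Integer.Properties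
  open import Algebra.Properties.AbelianGroup +-0-abelianGroup using (∙-cancelˡ)
  open import Data.Integer.Tactic.RingSolver using (solve-∀)
  open import Data.List.Base using (List; []; _∷_; lookup)
  open import Data.List.Relation.Unary.All using (All; []; _∷_)
  open import Data.Fin.Base using (zero; suc)
  open import Function.Base using (_∘_)
  open import Relation.Binary.PropositionalEquality

  lookup-positive : ∀ l → (∀ i → 0 ℕ.< lookup l i) → All (0 ℕ.<_) l
  lookup-positive []      0<l = []
  lookup-positive (a ∷ l) 0<l = 0<l zero ∷ lookup-positive l (0<l ∘ suc)

  -- Since B · (- ε B) ≡ 1 (mod D), the congruence A + B m ≡ 0 has the solution m ≡ ε A B. Exactly,
  -- ε B² = ε A D - 1 gives A + B (ε A B) = D (ε A²), and the summand D k of m contributes D (k B).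
  unimodular-divides : ∀ A B D ε k → A * D - B * B ≡ ε → ε * ε ≡ + 1 →
                       D * (ε * A * A + k * B) ≡ A + B * (ε * A * B + D * k)
  unimodular-divides A B D ε k det ε² = begin
    D * (ε * A * A + k * B)                               ≡⟨ split A B D ε k ⟩
    A * (ε * (A * D - B * B)) + B * (ε * A * B + D * k)   ≡⟨ cong (λ t → A * (ε * t) + rest) det ⟩
    A * (ε * ε) + B * (ε * A * B + D * k)                 ≡⟨ cong (λ t → A * t + rest) ε² ⟩
    A * + 1 + B * (ε * A * B + D * k)                     ≡⟨ cong (λ t → t + rest) (*-identityʳ A) ⟩
    A + B * (ε * A * B + D * k)                           ∎
    where
    open ≡-Reasoning
    rest = B * (ε * A * B + D * k)
    split : ∀ A B D ε k → D * (ε * A * A + k * B)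
                        ≡ A * (ε * (A * D - B * B)) + B * (ε * A * B + D * k)
    split = solve-∀

  0≤i+∣i∣ : ∀ i → + 0 ≤ i + + ∣ i ∣
  0≤i+∣i∣ (+ n)       = ℤ.+≤+ ℕ.z≤n
  0≤i+∣i∣ (-[1+ n ])  = ≤-reflexive (sym (+-inverseˡ (+ suc n)))

  -- As z ≥ 1 and k ≥ 0, replacing z k by k only lowers the sum, and k ≥ 1 + ∣w∣ already outweighs a
  -- negative w. This is the origin of `k₁`.
  1≤w+zk : ∀ w {z k} → + 1 ≤ z → + 1 + + ∣ w ∣ ≤ k → + 1 ≤ w + z * k
  1≤w+zk w {z} {k} 1≤z k₁≤k = begin
    + 1                     ≤⟨ +-monoʳ-≤ (+ 1) (0≤i+∣i∣ w) ⟩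
    + 1 + (w + + ∣ w ∣)     ≡⟨ swap w (+ ∣ w ∣) ⟩
    w + (+ 1 + + ∣ w ∣)     ≤⟨ +-monoʳ-≤ w k₁≤k ⟩
    w + k                   ≡⟨ cong (λ t → w + t) (*-identityˡ k) ⟨
    w + + 1 * k             ≤⟨ +-monoʳ-≤ w (*-monoʳ-≤-nonNeg k {{ℤ.nonNegative 0≤k}} 1≤z) ⟩
    w + z * k               ∎
    where
    open ≤-Reasoning
    swap : ∀ w v → + 1 + (w + v) ≡ w + (+ 1 + v)
    swap = solve-∀
    0≤k : + 0 ≤ k
    0≤k = ≤-trans (ℤ.+≤+ ℕ.z≤n) k₁≤k

  +∣i∣≡i : ∀ {i} → + 1 ≤ i → + ∣ i ∣ ≡ i
  +∣i∣≡i 1≤i = 0≤i⇒+∣i∣≡i (≤-trans (ℤ.+≤+ ℕ.z≤n) 1≤i)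

  0<∣i∣ : ∀ {i} → + 1 ≤ i → 0 ℕ.< ∣ i ∣
  0<∣i∣ {+ suc n} _ = ℕ.s≤s ℕ.z≤n
  0<∣i∣ {+ zero} (ℤ.+≤+ ())

  w+z[k+n]-injective : ∀ w z k {m n} .{{_ : ℤ.NonZero z}} →
                       w + z * (k + + m) ≡ w + z * (k + + n) → m ≡ n
  w+z[k+n]-injective w z k eq =
    +-injective (∙-cancelˡ k _ _ (*-cancelˡ-≡ z _ _ (∙-cancelˡ w _ _ eq)))

open import Data.Nat using (ℕ; suc)
open import Data.Integer using (ℤ; _+_; _*_; _≤_; +_; ∣_∣)
open import Data.List using (List; length; lookup; _++_; _∷_; [])
open import Data.Fin using (Fin; toℕ; fromℕ<; opposite)
open import Data.Product using (Σ; ∃; ∃-syntax; _×_; _,_)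
open import Relation.Nullary using (¬_)
open import Relation.Binary.PropositionalEquality using (_≡_; _≢_)

theorem2p2 : (as : List ℕ) → 1 Data.Nat.≤ length as →
    (∀ i → 0 Data.Nat.< lookup as i) →
    (∀ i → lookup as i ≡ lookup as (opposite i)) →
    ∃[ k₁ ] ∃[ w ] ∃[ z ]
    ((∀ (k : ℤ) → k₁ ≤ k →
    (+ 1 ≤ w + z * k)
    × IsCauchy (periodicCF (as ++ (∣ w + z * k ∣ ∷ [])))
    × IsAlgebraicIntegerOfDegree2 (periodicCF (as ++ (∣ w + z * k ∣ ∷ [])))
    × Positive (periodicCF (as ++ (∣ w + z * k ∣ ∷ [])))
    × LessThanOne (periodicCF (as ++ (∣ w + z * k ∣ ∷ []))))
    × (Σ (ℕ → ℤ) λ g → ((∀ (i : ℕ) → k₁ ≤ g i)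
    × (∀ (i j : ℕ) → i ≢ j →
    ¬ (periodicCF (as ++ (∣ w + z * g i ∣ ∷ []))
    ≃ᵣ periodicCF (as ++ (∣ w + z * g j ∣ ∷ [])))))))
theorem2p2 as 1≤length-as 0<lookup palindrome =
  k₁ , w , z , Root.properties , g , k₁≤g , distinct
  where
  open import Data.Integer using (NonZero; >-nonZero; +≤+; +<+; _-_)
  open import Data.Integer.Properties using (i≤i+j)
  import Data.Nat.Properties as ℕₚ
  open import Data.List.Properties using (length-++)
  open import Data.List.Relation.Unary.All using (All)
  open import Relation.Binary.PropositionalEquality using (sym; trans; cong; subst)

  0<as : All (0 Data.Nat.<_) as
  0<as = lookup-positive as 0<lookup

  sym-as : den₋ as ≡ num as
  sym-as = palindrome-num as palindrome

  A B z w k₁ : ℤ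
  A  = + num₋ as
  B  = + num as
  z  = + den as
  w  = sign as * A * B
  k₁ = + 1 + + ∣ w ∣

  g : ℕ → ℤ
  g i = k₁ + + i

  k₁≤g : ∀ i → k₁ ≤ g i
  k₁≤g i = i≤i+j k₁ (+ i)

  z≢0 : NonZero z
  z≢0 = >-nonZero (+<+ (1≤den 0<as))

  det : A * z - B * B ≡ sign as
  det = trans (cong (λ t → A * z - B * + t) (sym sym-as)) (determinant as)

  module Root (k : ℤ) (k₁≤k : k₁ ≤ k) where

    1≤m : + 1 ≤ w + z * k
    1≤m = 1≤w+zk w (+≤+ (1≤den 0<as)) k₁≤k

    module P = PeriodicRoot as 0<as sym-as ∣ w + z * k ∣ (0<∣i∣ 1≤m) (sign as * A * A + k * B)
      (trans (unimodular-divides A B z (sign as) k det (sign² as))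
             (cong (λ t → A + B * t) (sym (+∣i∣≡i 1≤m))))

    x>0 : Positive P.x
    x>0 = periodicCF-positive P.1≤length P.0<l

    x<1 : LessThanOne P.x
    -- A nonempty `as` together with the appended entry supplies the two entries required.
    x<1 = periodicCF-<1
      (subst (2 Data.Nat.≤_) (sym (length-++ as)) (ℕₚ.+-monoˡ-≤ 1 1≤length-as)) P.0<l

    properties = 1≤m , P.isCauchy , quadratic-integer x>0 x<1 P.bounded P.root , x>0 , x<1

  distinct : ∀ i j → i ≢ j → ¬ (periodicCF (as ++ (∣ w + z * g i ∣ ∷ []))
                                ≃ᵣ periodicCF (as ++ (∣ w + z * g j ∣ ∷ [])))
  distinct i j i≢j =
    quadratic-separates I.x>0 I.x<1 I.P.bounded I.P.root J.P.bounded J.P.root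
      -- The linear coefficient of each quadratic is the appended entry itself, which determines the
      -- index because `z` is nonzero.
      (λ mᵢ≡mⱼ → i≢j (w+z[k+n]-injective w z k₁ {{z≢0}}
        (trans (sym (+∣i∣≡i I.1≤m)) (trans mᵢ≡mⱼ (+∣i∣≡i J.1≤m)))))
    where
    module I = Root (g i) (k₁≤g i)
    module J = Root (g j) (k₁≤g j)
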